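{- There exist infinitely many (pairwise non-isomorphic) planar graphs $G$ with $\chi_1(G) = 3$.
   Context: All graphs are finite and simple. A mapping $f : V(G) \to E(G) \cup \{\emptyset\}$ is a $1$-selection of $G$ if for every $v \in V(G)$ either $f(v)$ is an edge incident with $v$ or $f(v) = \emptyset$. The graph $G_f$ is obtained from $G$ by deleting all edges in $f(V(G))$. The robust chromatic number is $\chi_1(G) = \min_f \chi(G_f)$, the minimum over all $1$-selections $f$ of $G$ of the chromatic number of $G_f$. -}

module Defs where

open import Data.Bool.Base using (Bool; false; T; not; _∧_)
open import Data.Fin.Base using (Fin; _<_)
open import Data.Fin.Properties using (_≟_; any?)
open import Data.List.Base using (List; []; _∷_)
open import Data.Maybe.Base using (Maybe)
open import Data.Maybe.Relation.Unary.All using (All)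
open import Data.Maybe.Relation.Unary.Any as Any using (Any)
open import Data.Nat.Base using (ℕ; _≤_)
open import Data.Product.Base using (∃-syntax; Σ-syntax; _×_; _,_)
open import Data.Rational.Base as ℚ using (ℚ; 0ℚ; 1ℚ)
open import Data.Sum.Base as Sum using (_⊎_)
open import Function.Bundles using (_↔_; mk⇔; Inverse)
open import Function.Definitions using (Injective)
open import Relation.Binary.PropositionalEquality using (_≡_; _≢_; cong; cong₂)
open import Relation.Nullary.Decidable using (Dec; does; _×-dec_; _⊎-dec_; does-⇔)

record Graph : Set where
  field
    order      : ℕ
    adj        : Fin order → Fin order → Bool
    adj-sym    : ∀ u v → adj u v ≡ adj v u
    adj-irrefl : ∀ v → adj v v ≡ false

  Vertex : Set
  Vertex = Fin order

  _~_ : Vertex → Vertex → Set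
  u ~ v = T (adj u v)

  -- An unordered pair of adjacent vertices, stored with its smaller end first.
  -- The proofs are irrelevant, so two edges with the same ends are equal.
  record Edge : Set where
    constructor edge
    field
      end₁ end₂ : Vertex
      .ordered  : end₁ < end₂
      .adjacent : end₁ ~ end₂

  open Edge public

  Incident : Vertex → Edge → Set
  Incident v e = v ≡ end₁ e ⊎ v ≡ end₂ e

  Joins : Vertex → Vertex → Edge → Set
  Joins u v e = (end₁ e ≡ u × end₂ e ≡ v) ⊎ (end₁ e ≡ v × end₂ e ≡ u)

  joins? : ∀ u v e → Dec (Joins u v e)
  joins? u v e = (end₁ e ≟ u ×-dec end₂ e ≟ v) ⊎-dec (end₁ e ≟ v ×-dec end₂ e ≟ u)

open Graph using (Vertex; Edge; Incident)

Isomorphic : Graph → Graph → Set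
Isomorphic G H =
  Σ[ φ ∈ Vertex G ↔ Vertex H ]
    (∀ u v → Graph.adj G u v ≡ Graph.adj H (Inverse.to φ u) (Inverse.to φ v))

Colorable : Graph → ℕ → Set
Colorable G k = Σ[ c ∈ (Vertex G → Fin k) ] (∀ u v → u ~ v → c u ≢ c v)
  where open Graph G using (_~_)

IsLeast : (ℕ → Set) → ℕ → Set
IsLeast P k = P k × (∀ m → P m → k ≤ m)

IsChromaticNumber : Graph → ℕ → Set
IsChromaticNumber G = IsLeast (Colorable G)

-- The value ∅ of a 1-selection is `nothing`.
record Selection (G : Graph) : Set where
  field
    select   : Vertex G → Maybe (Edge G)
    incident : ∀ v → All (Incident G v) (select v)

module _ (G : Graph) (f : Selection G) where
  open Graph G using (order; adj; adj-sym; adj-irrefl; Joins; joins?)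
  open Selection f

  Deleted : Vertex G → Vertex G → Set
  Deleted u v = ∃[ w ] Any (Joins u v) (select w)

  deleted? : ∀ u v → Dec (Deleted u v)
  deleted? u v = any? (λ w → Any.dec (joins? u v) (select w))

  private
    swap : ∀ {u v} → Deleted u v → Deleted v u
    swap (w , j) = w , Any.map Sum.swap j

  deleteSelected : Graph
  deleteSelected = record
    { order      = order
    ; adj        = λ u v → adj u v ∧ not (does (deleted? u v))
    ; adj-sym    = λ u v → cong₂ (λ a d → a ∧ not d) (adj-sym u v)
                     (does-⇔ (mk⇔ swap swap) (deleted? u v) (deleted? v u))
    ; adj-irrefl = λ v → cong (_∧ not (does (deleted? v v))) (adj-irrefl v)
    }

IsRobustChromaticNumber : Graph → ℕ → Set
IsRobustChromaticNumber G =
  IsLeast (λ k → Σ[ f ∈ Selection G ] IsChromaticNumber (deleteSelected G f) k)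

-- Plane graphs are drawn with polygonal arcs whose corners are rational. Every
-- planar graph has such a drawing, and segments with rational ends that meet in
-- ℝ² also meet in a point of ℚ², so it suffices to compare rational points.
Point : Set
Point = ℚ × ℚ

_∈[_,_] : Point → Point → Point → Set
(x , y) ∈[ (x₁ , y₁) , (x₂ , y₂) ] =
  ∃[ t ] 0ℚ ℚ.≤ t × t ℚ.≤ 1ℚ
       × x ≡ x₁ ℚ.+ t ℚ.* (x₂ ℚ.- x₁)
       × y ≡ y₁ ℚ.+ t ℚ.* (y₂ ℚ.- y₁)

-- p lies on the polygonal path from a to b with the given intermediate corners.
OnPath : Point → Point → List Point → Point → Set
OnPath p a []       b = p ∈[ a , b ]
OnPath p a (c ∷ cs) b = p ∈[ a , c ] ⊎ OnPath p c cs b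

-- The path from a to b does not meet itself, i.e. it is an arc.
IsArc : Point → List Point → Point → Set
IsArc a []       b = a ≢ b
IsArc a (c ∷ cs) b =
  a ≢ c × (∀ p → p ∈[ a , c ] → OnPath p c cs b → p ≡ c) × IsArc c cs b

record PlaneDrawing (G : Graph) : Set where
  open Graph G using (end₁; end₂)
  field
    position : Vertex G → Point
    corners  : Edge G → List Point

  _On_ : Point → Edge G → Set
  p On e = OnPath p (position (end₁ e)) (corners e) (position (end₂ e))

  field
    position-injective : Injective _≡_ _≡_ position
    edge-isArc         : ∀ e → IsArc (position (end₁ e)) (corners e) (position (end₂ e))
    vertex-on-edge     : ∀ v e → position v On e → Incident G v e
    edges-meet-at-ends : ∀ e e′ → e ≢ e′ → ∀ p → p On e → p On e′ →
                         ∃[ v ] Incident G v e × Incident G v e′ × p ≡ position v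

Planar : Graph → Set
Planar = PlaneDrawing

{-# OPTIONS --safe #-}

-- Two colours fail for G exactly when no 2-colouring lets every monochromatic
-- edge be selected by one of its ends, each vertex selecting at most one edge.
-- Take K₄, stack a vertex into three of its faces, and into each of the nine
-- faces around these vertices put the dual of Tutte's fragment (7 inner
-- vertices). That the fragment has no Hamiltonian path through two particular
-- ports means: if the stacked vertex of such a face is coloured unlike its
-- other two corners, then the inner vertices cannot select all monochromatic
-- edges of the fragment, so a corner must select one. For each colouring of the
-- 7 hubs, the monochromatic edges between hubs and the fragments in this
-- situation are more than 7 in number, while the hubs select at most 7 edges.
-- Adding isolated vertices turns this one graph into an infinite family.
module Submission where

open import Defs
open import Data.Bool.Base using (Bool; true; false; T; not)
import Data.Bool.Properties as Bool
open import Data.Empty using (⊥; ⊥-elim)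
open import Data.Fin.Base as Fin using (Fin; toℕ; _↑ˡ_; _↑ʳ_; splitAt; combine; remQuot; inject≤)
open import Data.Fin.Patterns
open import Data.Fin.Permutation using (↔⇒≡)
open import Data.Fin.Properties as Fin using (_≟_; all?; any?)
open import Data.Integer.Base as ℤ using (+_)
import Data.Integer.Properties as ℤ
open import Data.List.Base as List using (List; []; _∷_; _++_; length; filter; concatMap; allFin)
open import Data.List.Membership.Propositional using (_∈_; find; lose)
open import Data.List.Membership.Propositional.Properties using (∈-map⁺; ∈-++⁺ˡ; ∈-++⁺ʳ; ∈-++⁻; ∈-map⁻; ∈-concatMap⁺; ∈-filter⁻; ∈-allFin; ∈-lookup)
open import Data.List.Relation.Unary.All as All using (All; []; _∷_)
open import Data.List.Relation.Unary.AllPairs as AllPairs using (AllPairs; []; _∷_)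
open import Data.List.Relation.Unary.AllPairs.Properties using (map⁻)
open import Data.List.Relation.Unary.Any as Any using (Any; here; there; index)
open import Data.List.Relation.Unary.Any.Properties using (lookup-index)
open import Data.List.Relation.Unary.Unique.Propositional using (Unique)
open import Data.List.Relation.Unary.Unique.Propositional.Properties using (filter⁺)
open import Data.Maybe.Base as Maybe using (Maybe; just; nothing)
import Data.Maybe.Properties as Maybe
import Data.Maybe.Relation.Unary.All as MAll
import Data.Maybe.Relation.Unary.Any as MAny
open import Data.Nat.Base as ℕ using (ℕ; zero; suc; z≤n)
import Data.Nat.Coprimality as Coprime
open import Data.Nat.DivMod using (_mod_)
import Data.Nat.Properties as ℕ
import Data.Nat.Solver as ℕSolver
open import Data.Product.Base using (Σ-syntax; ∃-syntax; _×_; _,_; proj₁; proj₂; map₂; swap)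
open import Data.Product.Properties using (≡-dec; ,-injective)
open import Data.Rational.Base as ℚ using (ℚ; mkℚ; 0ℚ; 1ℚ; *≤*; *<*)
import Data.Rational.Properties as ℚ
open import Data.Rational.Solver using (module +-*-Solver)
import Data.Rational.Unnormalised.Base as ℚᵘ
import Data.Rational.Unnormalised.Properties as ℚᵘ
open import Data.Sum.Base as Sum using (_⊎_; inj₁; inj₂; [_,_]′)
import Data.Sum.Properties as Sum
open import Data.Unit.Base using (⊤; tt)
open import Data.Vec.Base using (Vec; []; _∷_; lookup; tabulate)
open import Data.Vec.Properties using (lookup∘tabulate)
open import Function.Base using (_∘_; const)
open import Function.Bundles using (mk⇔; Injection; Inverse; Equivalence)
open import Function.Properties.Inverse using (Inverse⇒Injection)
open import Relation.Binary.PropositionalEquality using (_≡_; _≢_; refl; sym; trans; cong; cong₂; subst; subst₂)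
open import Relation.Nullary.Decidable using (Dec; yes; no; does; map′; from-yes; recompute; _×-dec_; _⊎-dec_; _→-dec_; ¬?; does-⇔)
open import Relation.Nullary.Negation.Core using (¬_; contradiction)
open import Relation.Unary using (Decidable)

-- Counting and exhaustive search

unique-lookup : ∀ {A : Set} {xs : List A} → Unique xs →
  ∀ i j → List.lookup xs i ≡ List.lookup xs j → i ≡ j
unique-lookup (_  ∷ _) Fin.zero    Fin.zero    _  = refl
unique-lookup (x∉ ∷ _) Fin.zero    (Fin.suc j) eq = contradiction eq (All.lookup x∉ (∈-lookup j))
unique-lookup (x∉ ∷ _) (Fin.suc i) Fin.zero    eq = contradiction (sym eq) (All.lookup x∉ (∈-lookup i))
unique-lookup (_  ∷ u) (Fin.suc i) (Fin.suc j) eq = cong Fin.suc (unique-lookup u i j eq)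

-- Sending each element of `xs` to the position of its holder in `ys` is injective, because a holder
-- holds only one element. It is applied with edges held by inner vertices and with demands held by
-- hubs.
pigeonhole : ∀ {A B : Set} (R : A → B → Set) {xs : List A} {ys : List B} → Unique xs →
  (∀ {x} → x ∈ xs → ∃[ y ] y ∈ ys × R x y) →
  (∀ {x x′ y} → x ∈ xs → x′ ∈ xs → R x y → R x′ y → x ≡ x′) →
  length xs ℕ.≤ length ys
pigeonhole R {xs} {ys} unique holder functional = Fin.injective⇒≤ {f = hole} hole-injective
  where
  held : ∀ i → ∃[ y ] y ∈ ys × R (List.lookup xs i) y
  held i = holder (∈-lookup i)

  hole : Fin (length xs) → Fin (length ys)
  hole i = index (proj₁ (proj₂ (held i)))

  hole-value : ∀ i → proj₁ (held i) ≡ List.lookup ys (hole i)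
  hole-value i = lookup-index (proj₁ (proj₂ (held i)))

  hole-injective : ∀ {i j} → hole i ≡ hole j → i ≡ j
  hole-injective {i} {j} eq = unique-lookup unique i j
    (functional (∈-lookup i) (∈-lookup j) (proj₂ (proj₂ (held i)))
      (subst (R (List.lookup xs j)) (sym same) (proj₂ (proj₂ (held j)))))
    where
    same : proj₁ (held i) ≡ proj₁ (held j)
    same = trans (hole-value i) (trans (cong (List.lookup ys) eq) (sym (hole-value j)))

-- Colourings are vectors rather than functions, so that running through all `2 ^ n` of them settles
-- a universal statement without function extensionality.
allVec? : ∀ {n} {P : Vec Bool n → Set} → Decidable P → Dec (∀ v → P v)
allVec? {zero}  P? = map′ (λ p → λ { [] → p }) (λ f → f []) (P? [])
allVec? {suc n} P? =
  map′ (λ (t , f) → λ { (true ∷ v) → t v ; (false ∷ v) → f v })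
       (λ f → (λ v → f (true ∷ v)) , (λ v → f (false ∷ v)))
       (allVec? (P? ∘ (true ∷_)) ×-dec allVec? (P? ∘ (false ∷_)))

from-does : ∀ {A : Set} (a? : Dec A) → T (does a?) → A
from-does (yes a) _ = a

to-does : ∀ {A : Set} (a? : Dec A) → A → T (does a?)
to-does (yes _) _ = tt
to-does (no ¬a) a = ¬a a

-- Colourings after deletion

module _ (G : Graph) (f : Selection G) where
  open Graph G using (_~_; Joins)
  open Selection f

  SelectedBy : Graph.Vertex G → Graph.Vertex G → Graph.Vertex G → Set
  SelectedBy w u v = MAny.Any (Joins u v) (select w)

  -- A vertex selects only edges incident with it, so whichever `w` selected the edge is one of its
  -- two ends.
  deleted⇒selected : ∀ {u v} → Deleted G f u v → SelectedBy u u v ⊎ SelectedBy v u v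
  deleted⇒selected {u} {v} (w , joined) = go (incident w) joined
    where
    at : ∀ {x} → w ≡ x → SelectedBy x u v
    at refl = joined

    go : ∀ {m} → MAll.All (Graph.Incident G w) m → MAny.Any (Joins u v) m →
      SelectedBy u u v ⊎ SelectedBy v u v
    go (MAll.just (inj₁ w≡)) (MAny.just (inj₁ (p , q))) = inj₁ (at (trans w≡ p))
    go (MAll.just (inj₂ w≡)) (MAny.just (inj₁ (p , q))) = inj₂ (at (trans w≡ q))
    go (MAll.just (inj₁ w≡)) (MAny.just (inj₂ (p , q))) = inj₂ (at (trans w≡ p))
    go (MAll.just (inj₂ w≡)) (MAny.just (inj₂ (p , q))) = inj₁ (at (trans w≡ q))

  same⇒selected : ∀ {m u v} ((c , _) : Colorable (deleteSelected G f) m) →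
    u ~ v → c u ≡ c v → SelectedBy u u v ⊎ SelectedBy v u v
  same⇒selected {u = u} {v} (c , proper) u~v same = deleted⇒selected
    (decide (deleted? G f u v) λ remains → proper u v (Equivalence.from Bool.T-∧ (u~v , remains)) same)
    where
    decide : ∀ {D : Set} (d? : Dec D) → ¬ T (not (does d?)) → D
    decide (yes d) _       = d
    decide (no _)  ¬remain = contradiction tt ¬remain

  colorable : ∀ {m} (c : Graph.Vertex G → Fin m) →
    (∀ {u v} → u ~ v → c u ≡ c v → Deleted G f u v) → Colorable (deleteSelected G f) m
  colorable c deletes = c , λ u v remains same →
    let u~v , ¬deleted = Equivalence.to Bool.T-∧ remains
    in refute (deleted? G f u v) ¬deleted (deletes u~v same)
    where
    refute : ∀ {D : Set} (d? : Dec D) → T (not (does d?)) → ¬ D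
    refute (no ¬d) _ = ¬d

-- Edge lists and isolated vertices

Pair : ℕ → Set
Pair n = Fin n × Fin n

-- The trace that a 1-selection and a 2-colouring of the remaining graph leave on an edge list. No
-- isolated vertex is mentioned, so one refutation serves the whole family. `selects?` permits the
-- case distinction on whether a corner of a fragment selects an edge there.
record Cover {n : ℕ} (links : List (Pair n)) : Set₁ where
  field
    color      : Fin n → Bool
    Selects    : Fin n → Pair n → Set
    selects?   : ∀ s l → Dec (Selects s l)
    functional : ∀ {s l l′} → l ∈ links → l′ ∈ links → Selects s l → Selects s l′ → l ≡ l′
    covers     : ∀ {l} → l ∈ links → color (proj₁ l) ≡ color (proj₂ l) →
                 Selects (proj₁ l) l ⊎ Selects (proj₂ l) l

module Extension {n : ℕ} (links : List (Pair n))
  (ordered : ∀ {l} → l ∈ links → proj₁ l Fin.< proj₂ l) (i : ℕ) where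

  Vertex : Set
  Vertex = Fin (n ℕ.+ i)

  ι : Fin n → Vertex
  ι c = c ↑ˡ i

  Between : Vertex → Vertex → Pair n → Set
  Between u v (a , b) = (ι a ≡ u × ι b ≡ v) ⊎ (ι a ≡ v × ι b ≡ u)

  Linked : Vertex → Vertex → Set
  Linked u v = Any (Between u v) links

  linked? : ∀ u v → Dec (Linked u v)
  linked? u v = Any.any? (λ (a , b) → (ι a ≟ u ×-dec ι b ≟ v) ⊎-dec (ι a ≟ v ×-dec ι b ≟ u)) links

  linked-sym : ∀ {u v} → Linked u v → Linked v u
  linked-sym = Any.map Sum.swap

  ι-mono-< : ∀ {a b} → a Fin.< b → ι a Fin.< ι b
  ι-mono-< {a} {b} = subst₂ ℕ._<_ (sym (Fin.toℕ-↑ˡ a i)) (sym (Fin.toℕ-↑ˡ b i))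

  linked-irrefl : ∀ {v} → ¬ Linked v v
  linked-irrefl linked with find linked
  ... | _ , l∈ , inj₁ (refl , q) = Fin.<-irrefl (sym q) (ι-mono-< (ordered l∈))
  ... | _ , l∈ , inj₂ (refl , q) = Fin.<-irrefl (sym q) (ι-mono-< (ordered l∈))

  graph : Graph
  graph = record
    { order      = n ℕ.+ i
    ; adj        = λ u v → does (linked? u v)
    ; adj-sym    = λ u v → does-⇔ (mk⇔ linked-sym linked-sym) (linked? u v) (linked? v u)
    ; adj-irrefl = λ v → irrefl (linked? v v)
    }
    where
    irrefl : ∀ {v} (d : Dec (Linked v v)) → does d ≡ false
    irrefl (yes linked) = contradiction linked linked-irrefl
    irrefl (no _)       = refl

  open Graph graph using (Edge; edge; end₁; end₂; Incident; Joins; joins?; _~_)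

  link⇒adjacent : ∀ {l} → l ∈ links → ι (proj₁ l) ~ ι (proj₂ l)
  link⇒adjacent {a , b} l∈ = to-does (linked? (ι a) (ι b)) (lose l∈ (inj₁ (refl , refl)))

  linkEdge : ∀ {l} → l ∈ links → Edge
  linkEdge {a , b} l∈ = edge (ι a) (ι b) (ι-mono-< (ordered l∈)) (link⇒adjacent l∈)

  edge⇒link : ∀ (e : Edge) → ∃[ l ] l ∈ links × ι (proj₁ l) ≡ end₁ e × ι (proj₂ l) ≡ end₂ e
  edge⇒link (edge u v u<v u~v)
    -- The proofs stored in an `Edge` are irrelevant; decidability recovers usable ones. A link with
    -- the ends reversed would contradict the two orderings.
    with find (recompute (linked? u v) (from-does (linked? u v) u~v))
  ... | l , l∈ , inj₁ (p , q) = l , l∈ , p , q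
  ... | l , l∈ , inj₂ (refl , refl) =
    contradiction (ι-mono-< (ordered l∈)) (Fin.<-asym (recompute (u Fin.<? v) u<v))

  -- If the two links ran along `e` in opposite directions, one of them would have its larger end
  -- first, against `ordered`.
  joins-unique : ∀ {e l l′} → l ∈ links → l′ ∈ links →
    Joins (ι (proj₁ l)) (ι (proj₂ l)) e → Joins (ι (proj₁ l′)) (ι (proj₂ l′)) e → l ≡ l′
  joins-unique _ _ (inj₁ (p , q)) (inj₁ (p′ , q′)) =
    cong₂ _,_ (Fin.↑ˡ-injective i _ _ (trans (sym p) p′)) (Fin.↑ˡ-injective i _ _ (trans (sym q) q′))
  joins-unique _ _ (inj₂ (p , q)) (inj₂ (p′ , q′)) =
    cong₂ _,_ (Fin.↑ˡ-injective i _ _ (trans (sym q) q′)) (Fin.↑ˡ-injective i _ _ (trans (sym p) p′))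
  joins-unique l∈ l′∈ (inj₁ (p , q)) (inj₂ (p′ , q′)) = contradiction (ι-mono-< (ordered l∈))
    (Fin.<-asym (subst₂ Fin._<_ (trans (sym q′) q) (trans (sym p′) p) (ι-mono-< (ordered l′∈))))
  joins-unique l∈ l′∈ (inj₂ (p , q)) (inj₁ (p′ , q′)) = contradiction (ι-mono-< (ordered l∈))
    (Fin.<-asym (subst₂ Fin._<_ (trans (sym p′) p) (trans (sym q′) q) (ι-mono-< (ordered l′∈))))

  module _ (f : Selection graph) where
    open Selection f

    Selects : Fin n → Pair n → Set
    Selects s (a , b) = MAny.Any (Joins (ι a) (ι b)) (select (ι s))

    selects-unique : ∀ {m : Maybe Edge} {l l′} → l ∈ links → l′ ∈ links →
      MAny.Any (Joins (ι (proj₁ l)) (ι (proj₂ l))) m →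
      MAny.Any (Joins (ι (proj₁ l′)) (ι (proj₂ l′))) m → l ≡ l′
    selects-unique {just e} l∈ l′∈ (MAny.just j) (MAny.just j′) = joins-unique {e} l∈ l′∈ j j′

    two-coloring⇒cover : ∀ {m} → m ℕ.≤ 2 → Colorable (deleteSelected graph f) m → Cover links
    two-coloring⇒cover m≤2 (c , proper) = record
      { color      = λ v → Inverse.to Fin.2↔Bool (inject≤ (c (ι v)) m≤2)
      ; Selects    = Selects
      ; selects?   = λ s (a , b) → MAny.dec (joins? (ι a) (ι b)) (select (ι s))
      ; functional = selects-unique
      ; covers     = λ l∈ same → same⇒selected graph f (c , proper) (link⇒adjacent l∈)
                       (Fin.inject≤-injective m≤2 m≤2 _ _ (Injection.injective (Inverse⇒Injection Fin.2↔Bool) same))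
      }

    three≤ : ¬ Cover links → ∀ {m} → Colorable (deleteSelected graph f) m → 3 ℕ.≤ m
    three≤ ¬cover {m} colorable with m ℕ.≤? 2
    ... | no m≰2  = ℕ.≰⇒> m≰2
    ... | yes m≤2 = contradiction (two-coloring⇒cover m≤2 colorable) ¬cover

  module _ (color : Fin n → Fin 3) (choice : Fin n → Maybe (Pair n))
    (valid : ∀ v → MAll.All (λ l → (v ≡ proj₁ l ⊎ v ≡ proj₂ l) × l ∈ links) (choice v))
    (covers : ∀ {l} → l ∈ links → color (proj₁ l) ≡ color (proj₂ l) →
              choice (proj₁ l) ≡ just l ⊎ choice (proj₂ l) ≡ just l) where

    choose : ∀ v (m : Maybe (Pair n)) → MAll.All (λ l → (v ≡ proj₁ l ⊎ v ≡ proj₂ l) × l ∈ links) m →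
      Σ[ e ∈ Maybe Edge ] MAll.All (Incident (ι v)) e ×
        (∀ {l} → m ≡ just l → MAny.Any (Joins (ι (proj₁ l)) (ι (proj₂ l))) e)
    choose v nothing  _                     = nothing , MAll.nothing , λ ()
    choose v (just l) (MAll.just (inc , l∈)) =
      just (linkEdge l∈) , MAll.just (Sum.map (cong ι) (cong ι) inc) ,
      λ { refl → MAny.just (inj₁ (refl , refl)) }

    -- Speaking of any `v` with `v ≡ ι s`, rather than of `ι s`, lets `splitAt n v` be matched
    -- first. Isolated vertices select ∅.
    chosen : ∀ v → Σ[ e ∈ Maybe Edge ] MAll.All (Incident v) e ×
      (∀ {s l} → v ≡ ι s → choice s ≡ just l → MAny.Any (Joins (ι (proj₁ l)) (ι (proj₂ l))) e)
    chosen v with splitAt n v in eq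
    ... | inj₁ s with e , inc , sel ← choose s (choice s) (valid s) =
      e , subst (λ w → MAll.All (Incident w) e) (Fin.splitAt⁻¹-↑ˡ eq) inc ,
      λ {s′} v≡ chose → sel (trans (cong choice (Fin.↑ˡ-injective i s s′ (trans (Fin.splitAt⁻¹-↑ˡ eq) v≡))) chose)
    ... | inj₂ _ = nothing , MAll.nothing , λ {s′} v≡ _ →
      contradiction (trans (sym eq) (trans (cong (splitAt n) v≡) (Fin.splitAt-↑ˡ n s′ i))) λ ()

    selection : Selection graph
    selection = record
      { select   = λ v → proj₁ (chosen v)
      ; incident = λ v → proj₁ (proj₂ (chosen v))
      }

    -- Isolated vertices have no edges, so colour 0 is as good as any.
    colorᵉ : Vertex → Fin 3
    colorᵉ v = [ color , const Fin.zero ]′ (splitAt n v)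

    colorᵉ-ι : ∀ a → colorᵉ (ι a) ≡ color a
    colorᵉ-ι a = cong [ color , const Fin.zero ]′ (Fin.splitAt-↑ˡ n a i)

    link-deleted : ∀ {l} → l ∈ links → colorᵉ (ι (proj₁ l)) ≡ colorᵉ (ι (proj₂ l)) →
      Deleted graph selection (ι (proj₁ l)) (ι (proj₂ l))
    link-deleted {a , b} l∈ same with covers l∈ (trans (sym (colorᵉ-ι a)) (trans same (colorᵉ-ι b)))
    ... | inj₁ chose = ι a , proj₂ (proj₂ (chosen (ι a))) refl chose
    ... | inj₂ chose = ι b , proj₂ (proj₂ (chosen (ι b))) refl chose

    same⇒deleted : ∀ {u v} → u ~ v → colorᵉ u ≡ colorᵉ v → Deleted graph selection u v
    same⇒deleted {u} {v} u~v same with find (from-does (linked? u v) u~v)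
    ... | l , l∈ , inj₁ (refl , refl) = link-deleted l∈ same
    ... | l , l∈ , inj₂ (refl , refl) = map₂ (MAny.map Sum.swap) (link-deleted l∈ (sym same))

    -- `three≤` serves both minima: it bounds the chromatic number left by `selection` and the one
    -- left by every other selection.
    robust-three : ¬ Cover links → IsRobustChromaticNumber graph 3
    robust-three ¬cover =
      ( selection
      , colorable graph selection colorᵉ same⇒deleted
      , λ _ → three≤ selection ¬cover )
      , λ _ (f , c , _) → three≤ f ¬cover c

-- Straight-line drawings

-- Written directly in lowest terms, so that equal values have equal numerators by computation.
fromℕ : ℕ → ℚ
fromℕ n = mkℚ (+ n) 0 (Coprime.sym (Coprime.1-coprimeTo n))

fromℕ-injective : ∀ {m n} → fromℕ m ≡ fromℕ n → m ≡ n
fromℕ-injective refl = refl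

fromℕ-+ : ∀ m n → fromℕ (m ℕ.+ n) ≡ fromℕ m ℚ.+ fromℕ n
fromℕ-+ m n = ℚ.toℚᵘ-injective (ℚᵘ.≃-trans
  (ℚᵘ.*≡* (cong (ℤ._* (+ 1)) (sym (cong₂ ℤ._+_ (ℤ.*-identityʳ (+ m)) (ℤ.*-identityʳ (+ n))))))
  (ℚᵘ.≃-sym (ℚ.toℚᵘ-homo-+ (fromℕ m) (fromℕ n))))

fromℕ-* : ∀ m n → fromℕ (m ℕ.* n) ≡ fromℕ m ℚ.* fromℕ n
fromℕ-* m n = ℚ.toℚᵘ-injective (ℚᵘ.≃-trans
  (ℚᵘ.*≡* (cong (ℤ._* (+ 1)) (ℤ.pos-* m n)))
  (ℚᵘ.≃-sym (ℚ.toℚᵘ-homo-* (fromℕ m) (fromℕ n))))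

fromℕ-mono-< : ∀ {m n} → m ℕ.< n → fromℕ m ℚ.< fromℕ n
fromℕ-mono-< {m} {n} m<n = *<* (subst₂ ℤ._<_ (sym (ℤ.*-identityʳ (+ m))) (sym (ℤ.*-identityʳ (+ n))) (ℤ.+<+ m<n))

Site : Set
Site = ℕ × ℕ

point : Site → Point
point (x , y) = fromℕ x , fromℕ y

point-injective : ∀ {s t} → point s ≡ point t → s ≡ t
point-injective eq with p , q ← ,-injective eq = cong₂ _,_ (fromℕ-injective p) (fromℕ-injective q)

-- The two halves of the determinant that tells on which side of the line
-- through a and b the point c lies, split so that both are natural numbers.
plus minus : Site → Site → Site → ℕ
plus  (x₁ , y₁) (x₂ , y₂) (x , y) = x₁ ℕ.* y₂ ℕ.+ x₂ ℕ.* y ℕ.+ x ℕ.* y₁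
minus (x₁ , y₁) (x₂ , y₂) (x , y) = y₁ ℕ.* x₂ ℕ.+ y₂ ℕ.* x ℕ.+ y ℕ.* x₁

Left : Site → Site → Site → Set
Left a b c = minus a b c ℕ.< plus a b c

side : Point → Point → Point → ℚ
side (x₁ , y₁) (x₂ , y₂) (x , y) =
  (x₁ ℚ.* y₂ ℚ.+ x₂ ℚ.* y ℚ.+ x ℚ.* y₁) ℚ.- (y₁ ℚ.* x₂ ℚ.+ y₂ ℚ.* x ℚ.+ y ℚ.* x₁)

fromℕ-products : ∀ a b c d e f → fromℕ (a ℕ.* b ℕ.+ c ℕ.* d ℕ.+ e ℕ.* f) ≡
  fromℕ a ℚ.* fromℕ b ℚ.+ fromℕ c ℚ.* fromℕ d ℚ.+ fromℕ e ℚ.* fromℕ f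
fromℕ-products a b c d e f =
  trans (fromℕ-+ (a ℕ.* b ℕ.+ c ℕ.* d) (e ℕ.* f)) (cong₂ ℚ._+_
    (trans (fromℕ-+ (a ℕ.* b) (c ℕ.* d)) (cong₂ ℚ._+_ (fromℕ-* a b) (fromℕ-* c d)))
    (fromℕ-* e f))

side-point : ∀ a b c → side (point a) (point b) (point c) ≡ fromℕ (plus a b c) ℚ.- fromℕ (minus a b c)
side-point (x₁ , y₁) (x₂ , y₂) (x , y) = cong₂ ℚ._-_
  (sym (fromℕ-products x₁ y₂ x₂ y x y₁)) (sym (fromℕ-products y₁ x₂ y₂ x y x₁))

left⇒positive : ∀ a b c → Left a b c → 0ℚ ℚ.< side (point a) (point b) (point c)
left⇒positive a b c left = subst₂ ℚ._<_ (ℚ.+-inverseʳ (fromℕ (minus a b c))) (sym (side-point a b c))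
  (ℚ.+-monoˡ-< (ℚ.- fromℕ (minus a b c)) (fromℕ-mono-< left))

module _ where
  open +-*-Solver

  side-start : ∀ a b → side a b a ≡ 0ℚ
  side-start (x₁ , y₁) (x₂ , y₂) = solve 4 (λ x₁ y₁ x₂ y₂ →
    (x₁ :* y₂ :+ x₂ :* y₁ :+ x₁ :* y₁) :- (y₁ :* x₂ :+ y₂ :* x₁ :+ y₁ :* x₁) := con 0ℚ) refl x₁ y₁ x₂ y₂

  side-end : ∀ a b → side a b b ≡ 0ℚ
  side-end (x₁ , y₁) (x₂ , y₂) = solve 4 (λ x₁ y₁ x₂ y₂ →
    (x₁ :* y₂ :+ x₂ :* y₂ :+ x₂ :* y₁) :- (y₁ :* x₂ :+ y₂ :* x₂ :+ y₂ :* x₁) := con 0ℚ) refl x₁ y₁ x₂ y₂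

  -- Because the determinant is affine in its third point, its signs at the two ends of a segment
  -- control it on the whole segment.
  side-affine : ∀ x₁ y₁ x₂ y₂ x y x′ y′ t →
    side (x₁ , y₁) (x₂ , y₂) (x ℚ.+ t ℚ.* (x′ ℚ.- x) , y ℚ.+ t ℚ.* (y′ ℚ.- y)) ≡
    (1ℚ ℚ.- t) ℚ.* side (x₁ , y₁) (x₂ , y₂) (x , y) ℚ.+ t ℚ.* side (x₁ , y₁) (x₂ , y₂) (x′ , y′)
  side-affine = solve 9 (λ x₁ y₁ x₂ y₂ x y x′ y′ t →
    let sideₚ = λ x y → (x₁ :* y₂ :+ x₂ :* y :+ x :* y₁) :- (y₁ :* x₂ :+ y₂ :* x :+ y :* x₁)
    in sideₚ (x :+ t :* (x′ :- x)) (y :+ t :* (y′ :- y)) :=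
       (con 1ℚ :- t) :* sideₚ x y :+ t :* sideₚ x′ y′) refl

  reverse-coordinate : ∀ x x′ t → x ℚ.+ t ℚ.* (x′ ℚ.- x) ≡ x′ ℚ.+ (1ℚ ℚ.- t) ℚ.* (x ℚ.- x′)
  reverse-coordinate = solve 3 (λ x x′ t →
    x :+ t :* (x′ :- x) := x′ :+ (con 1ℚ :- t) :* (x :- x′)) refl

  start-coordinate : ∀ x x′ → x ℚ.+ 0ℚ ℚ.* (x′ ℚ.- x) ≡ x
  start-coordinate = solve 2 (λ x x′ → x :+ con 0ℚ :* (x′ :- x) := x) refl

≤⇒0≤- : ∀ {p q} → p ℚ.≤ q → 0ℚ ℚ.≤ q ℚ.- p
≤⇒0≤- {p} {q} p≤q = subst (ℚ._≤ q ℚ.- p) (ℚ.+-inverseʳ p) (ℚ.+-monoˡ-≤ (ℚ.- p) p≤q)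

∈-reverse : ∀ p a b → p ∈[ a , b ] → p ∈[ b , a ]
∈-reverse (x , y) (x₁ , y₁) (x₂ , y₂) (t , 0≤t , t≤1 , x≡ , y≡) =
  1ℚ ℚ.- t , ≤⇒0≤- t≤1 ,
  subst (1ℚ ℚ.- t ℚ.≤_) (ℚ.+-identityʳ 1ℚ) (ℚ.+-monoʳ-≤ 1ℚ (ℚ.neg-antimono-≤ 0≤t)) ,
  trans x≡ (reverse-coordinate x₁ x₂ t) , trans y≡ (reverse-coordinate y₁ y₂ t)

side-on : ∀ a b p c d ((t , _) : p ∈[ c , d ]) →
  side a b p ≡ (1ℚ ℚ.- t) ℚ.* side a b c ℚ.+ t ℚ.* side a b d
side-on (x₁ , y₁) (x₂ , y₂) _ (x , y) (x′ , y′) (t , _ , _ , refl , refl) =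
  side-affine x₁ y₁ x₂ y₂ x y x′ y′ t

on-line : ∀ a b p → p ∈[ a , b ] → side a b p ≡ 0ℚ
on-line a b p on@(t , _) = trans (side-on a b p a b on)
  (trans (cong₂ (λ u v → (1ℚ ℚ.- t) ℚ.* u ℚ.+ t ℚ.* v) (side-start a b) (side-end a b))
    (cong₂ ℚ._+_ (ℚ.*-zeroʳ (1ℚ ℚ.- t)) (ℚ.*-zeroʳ t)))

-- For positive `t` the second summand would be positive and the first nonnegative, so the sum could
-- not vanish.
convex-zero⇒start : ∀ t u v → 0ℚ ℚ.≤ t → t ℚ.≤ 1ℚ → 0ℚ ℚ.≤ u → 0ℚ ℚ.< v →
  (1ℚ ℚ.- t) ℚ.* u ℚ.+ t ℚ.* v ≡ 0ℚ → t ≡ 0ℚ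
convex-zero⇒start t u v 0≤t t≤1 0≤u 0<v sum≡0 = ℚ.≤-antisym (ℚ.≮⇒≥ ¬0<t) 0≤t
  where
  0≤first : ℚ.NonNegative ((1ℚ ℚ.- t) ℚ.* u)
  0≤first = ℚ.nonNeg*nonNeg⇒nonNeg (1ℚ ℚ.- t) {{ℚ.nonNegative (≤⇒0≤- t≤1)}} u {{ℚ.nonNegative 0≤u}}

  ¬0<t : ¬ (0ℚ ℚ.< t)
  ¬0<t 0<t = ℚ.<-irrefl (sym sum≡0) (ℚ.positive⁻¹ ((1ℚ ℚ.- t) ℚ.* u ℚ.+ t ℚ.* v)
    {{ℚ.nonNeg+pos⇒pos ((1ℚ ℚ.- t) ℚ.* u) {{0≤first}} (t ℚ.* v)
      {{ℚ.pos*pos⇒pos t {{ℚ.positive 0<t}} v {{ℚ.positive 0<v}}}}}})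

-- Along the segment `side a b` is a convex combination of a nonnegative and a positive value, so it
-- vanishes at most at parameter 0. Allowing `c` on the line covers segments with a shared end.
meets-at-start : ∀ a b c d p → 0ℚ ℚ.≤ side a b c → 0ℚ ℚ.< side a b d →
  side a b p ≡ 0ℚ → p ∈[ c , d ] → p ≡ c
meets-at-start a b c@(x , y) d@(x′ , y′) p 0≤c 0<d p≡0 on@(t , 0≤t , t≤1 , x≡ , y≡) =
  cong₂ _,_ (trans x≡ (at-start x x′)) (trans y≡ (at-start y y′))
  where
  t≡0 : t ≡ 0ℚ
  t≡0 = convex-zero⇒start t (side a b c) (side a b d) 0≤t t≤1 0≤c 0<d
    (trans (sym (side-on a b p c d on)) p≡0)

  at-start : ∀ z z′ → z ℚ.+ t ℚ.* (z′ ℚ.- z) ≡ z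
  at-start z z′ = trans (cong (λ s → z ℚ.+ s ℚ.* (z′ ℚ.- z)) t≡0) (start-coordinate z z′)

strictly-beside : ∀ a b c d p → 0ℚ ℚ.< side a b c → 0ℚ ℚ.< side a b d →
  side a b p ≡ 0ℚ → ¬ p ∈[ c , d ]
strictly-beside a b c d p 0<c 0<d p≡0 on =
  ℚ.<-irrefl (sym (trans (cong (side a b) (sym p≡c)) p≡0)) 0<c
  where
  p≡c : p ≡ c
  p≡c = meets-at-start a b c d p (ℚ.<⇒≤ 0<c) 0<d p≡0 on

∈-start : ∀ a b → a ∈[ a , b ]
∈-start (x , y) (x′ , y′) =
  0ℚ , ℚ.≤-refl , *≤* (ℤ.+≤+ z≤n) , sym (start-coordinate x x′) , sym (start-coordinate y y′)

-- Orientation tests certifying that segments meet only in common ends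

allPairs-lookup : ∀ {A : Set} {R : A → A → Set} {xs : List A} → AllPairs R xs →
  ∀ {x y} → x ∈ xs → y ∈ xs → x ≡ y ⊎ R x y ⊎ R y x
allPairs-lookup (_  ∷ _)  (here refl) (here refl) = inj₁ refl
allPairs-lookup (px ∷ _)  (here refl) (there y∈)  = inj₂ (inj₁ (All.lookup px y∈))
allPairs-lookup (py ∷ _)  (there x∈)  (here refl) = inj₂ (inj₂ (All.lookup py x∈))
allPairs-lookup (_  ∷ ps) (there x∈)  (there y∈)  = allPairs-lookup ps x∈ y∈

End : ∀ {n} → Fin n → Pair n → Set
End v (a , b) = v ≡ a ⊎ v ≡ b

end? : ∀ {n} v (l : Pair n) → Dec (End v l)
end? v (a , b) = v ≟ a ⊎-dec v ≟ b

left? : ∀ a b c → Dec (Left a b c)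
left? a b c = minus a b c ℕ.<? plus a b c

-- A pair of vertices together with their sites, which are then computed only once.
Segment : ℕ → Set
Segment n = Pair n × Site × Site

flip : ∀ {n} → Segment n → Segment n
flip (l , s , t) = swap l , t , s

LeftOf : ∀ {n} → Segment n → Site → Set
LeftOf (_ , s , t) = Left s t

-- The last two alternatives are for segments with a shared end: that end lies on the line, and only
-- the other one has to be tested.
Beside : ∀ {n} → Segment n → Segment n → Set
Beside e@(l , _) ((c , d) , s , t) =
  (LeftOf e s × LeftOf e t) ⊎ (End c l × LeftOf e t) ⊎ (End d l × LeftOf e s)

beside? : ∀ {n} (e e′ : Segment n) → Dec (Beside e e′)
beside? (l , s , t) ((c , d) , s′ , t′) =
  (left? s t s′ ×-dec left? s t t′) ⊎-dec (end? c l ×-dec left? s t t′) ⊎-dec (end? d l ×-dec left? s t s′)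

-- The separating line is sought only among the lines through the two segments, with either side of
-- each. All four tests compare natural numbers and are decided by evaluation.
Separated : ∀ {n} → Segment n → Segment n → Set
Separated e e′ = Beside e e′ ⊎ Beside (flip e) e′ ⊎ Beside e′ e ⊎ Beside (flip e′) e

separated? : ∀ {n} (e e′ : Segment n) → Dec (Separated e e′)
separated? e e′ = beside? e e′ ⊎-dec beside? (flip e) e′ ⊎-dec beside? e′ e ⊎-dec beside? (flip e′) e

module Segments {n : ℕ} (site : Fin n → Site) where

  segment : Pair n → Segment n
  segment l@(a , b) = l , site a , site b

  pos : Fin n → Point
  pos v = point (site v)

  _OnSegment_ : Point → Pair n → Set
  p OnSegment (a , b) = p ∈[ pos a , pos b ]

  reverse-segment : ∀ {p} l → p OnSegment l → p OnSegment swap l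
  reverse-segment {p} (a , b) = ∈-reverse p (pos a) (pos b)

  end-on-segment : ∀ {v} l → End v l → pos v OnSegment l
  end-on-segment (a , b) (inj₁ refl) = ∈-start (pos a) (pos b)
  end-on-segment (a , b) (inj₂ refl) = ∈-reverse (pos b) (pos b) (pos a) (∈-start (pos b) (pos a))

  CommonEnd : Pair n → Pair n → Point → Set
  CommonEnd l l′ p = ∃[ v ] End v l × End v l′ × p ≡ pos v

  end-on-line : ∀ {v} l → End v l → 0ℚ ℚ.≤ side (pos (proj₁ l)) (pos (proj₂ l)) (pos v)
  end-on-line (a , b) (inj₁ refl) = ℚ.≤-reflexive (sym (side-start (pos a) (pos b)))
  end-on-line (a , b) (inj₂ refl) = ℚ.≤-reflexive (sym (side-end (pos a) (pos b)))

  beside-meet : ∀ l l′ {p} → Beside (segment l) (segment l′) → p OnSegment l → p OnSegment l′ → CommonEnd l l′ p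
  beside-meet l@(a , b) (c , d) {p} (inj₁ (left-c , left-d)) on on′ =
    contradiction on′ (strictly-beside (pos a) (pos b) (pos c) (pos d) p
      (left⇒positive (site a) (site b) (site c) left-c)
      (left⇒positive (site a) (site b) (site d) left-d) (on-line (pos a) (pos b) p on))
  beside-meet l@(a , b) (c , d) {p} (inj₂ (inj₁ (end-c , left-d))) on on′ =
    c , end-c , inj₁ refl , meets-at-start (pos a) (pos b) (pos c) (pos d) p (end-on-line l end-c)
      (left⇒positive (site a) (site b) (site d) left-d) (on-line (pos a) (pos b) p on) on′
  beside-meet l@(a , b) (c , d) {p} (inj₂ (inj₂ (end-d , left-c))) on on′ =
    d , end-d , inj₂ refl , meets-at-start (pos a) (pos b) (pos d) (pos c) p (end-on-line l end-d)
      (left⇒positive (site a) (site b) (site c) left-c) (on-line (pos a) (pos b) p on) (reverse-segment (c , d) on′)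

  separated-meet : ∀ l l′ {p} → Separated (segment l) (segment l′) → p OnSegment l → p OnSegment l′ → CommonEnd l l′ p
  separated-meet l l′ (inj₁ beside) on on′ = beside-meet l l′ beside on on′
  separated-meet l l′ (inj₂ (inj₁ beside)) on on′ =
    let v , end , end′ , eq = beside-meet (swap l) l′ beside (reverse-segment l on) on′
    in v , Sum.swap end , end′ , eq
  separated-meet l l′ (inj₂ (inj₂ (inj₁ beside))) on on′ =
    let v , end′ , end , eq = beside-meet l′ l beside on′ on
    in v , end , end′ , eq
  separated-meet l l′ (inj₂ (inj₂ (inj₂ beside))) on on′ =
    let v , end′ , end , eq = beside-meet (swap l′) l beside (reverse-segment l′ on′) on
    in v , end , Sum.swap end′ , eq

-- The line x = w has the core on its left and carries the isolated vertices.
module Drawing {n : ℕ} (links : List (Pair n))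
  (ordered : ∀ {l} → l ∈ links → proj₁ l Fin.< proj₂ l)
  (site : Fin n → Site) (w : ℕ)
  (site-injective : ∀ a b → site a ≡ site b → a ≡ b)
  (site-left : ∀ a → Left (w , 0) (w , 1) (site a))
  (separated : AllPairs Separated (List.map (Segments.segment site) links))
  (touched : ∀ v → Any (End v) links)
  (i : ℕ) where

  open Extension links ordered i
  open Segments site
  open Graph graph using (Edge; edge; end₁; end₂; Incident)

  extended : Fin n ⊎ Fin i → Site
  extended = [ site , (λ j → w , toℕ j) ]′

  position : Vertex → Point
  position v = point (extended (splitAt n v))

  position-ι : ∀ a → position (ι a) ≡ pos a
  position-ι a = cong (point ∘ extended) (Fin.splitAt-↑ˡ n a i)

  wall-collinear : ∀ y → plus (w , 0) (w , 1) (w , y) ≡ minus (w , 0) (w , 1) (w , y)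
  wall-collinear y = solve 2 (λ w y →
    w :* con 1 :+ w :* y :+ w :* con 0 := con 0 :* w :+ con 1 :* w :+ y :* w) refl w y
    where open ℕSolver.+-*-Solver

  site≢wall : ∀ a y → site a ≢ (w , y)
  site≢wall a y eq = ℕ.<-irrefl (sym (wall-collinear y)) (subst (Left (w , 0) (w , 1)) eq (site-left a))

  extended-injective : ∀ x y → extended x ≡ extended y → x ≡ y
  extended-injective (inj₁ a) (inj₁ b) eq = cong inj₁ (site-injective a b eq)
  extended-injective (inj₁ a) (inj₂ j) eq = contradiction eq (site≢wall a (toℕ j))
  extended-injective (inj₂ j) (inj₁ b) eq = contradiction (sym eq) (site≢wall b (toℕ j))
  extended-injective (inj₂ j) (inj₂ k) eq = cong inj₂ (Fin.toℕ-injective (cong proj₂ eq))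

  position-injective : ∀ {u v} → position u ≡ position v → u ≡ v
  position-injective {u} {v} eq = trans (sym (Fin.join-splitAt n i u))
    (trans (cong (Fin.join n i) (extended-injective (splitAt n u) (splitAt n v) (point-injective eq)))
      (Fin.join-splitAt n i v))

  ends-differ : ∀ e → end₁ e ≢ end₂ e
  ends-differ (edge u v u<v _) eq = Fin.<-irrefl eq (recompute (u Fin.<? v) u<v)

  linkOf : Edge → Pair n
  linkOf e = proj₁ (edge⇒link e)

  linkOf∈ : ∀ e → linkOf e ∈ links
  linkOf∈ e = proj₁ (proj₂ (edge⇒link e))

  ι-end₁ : ∀ e → ι (proj₁ (linkOf e)) ≡ end₁ e
  ι-end₁ e = proj₁ (proj₂ (proj₂ (edge⇒link e)))

  ι-end₂ : ∀ e → ι (proj₂ (linkOf e)) ≡ end₂ e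
  ι-end₂ e = proj₂ (proj₂ (proj₂ (edge⇒link e)))

  edge-ext : ∀ {e e′ : Edge} → end₁ e ≡ end₁ e′ → end₂ e ≡ end₂ e′ → e ≡ e′
  edge-ext {edge _ _ _ _} {edge _ _ _ _} refl refl = refl

  linkOf-injective : ∀ e e′ → linkOf e ≡ linkOf e′ → e ≡ e′
  linkOf-injective e e′ eq = edge-ext
    (trans (sym (ι-end₁ e)) (trans (cong (ι ∘ proj₁) eq) (ι-end₁ e′)))
    (trans (sym (ι-end₂ e)) (trans (cong (ι ∘ proj₂) eq) (ι-end₂ e′)))

  end⇒incident : ∀ {v} e → End v (linkOf e) → Incident (ι v) e
  end⇒incident e (inj₁ refl) = inj₁ (ι-end₁ e)
  end⇒incident e (inj₂ refl) = inj₂ (ι-end₂ e)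

  on⇒segment : ∀ {p} e → p ∈[ position (end₁ e) , position (end₂ e) ] → p OnSegment linkOf e
  on⇒segment {p} e = subst₂ (p ∈[_,_])
    (trans (cong position (sym (ι-end₁ e))) (position-ι (proj₁ (linkOf e))))
    (trans (cong position (sym (ι-end₂ e))) (position-ι (proj₂ (linkOf e))))

  links-meet : ∀ {l l′ p} → l ∈ links → l′ ∈ links → p OnSegment l → p OnSegment l′ →
    l ≡ l′ ⊎ CommonEnd l l′ p
  links-meet {l} {l′} l∈ l′∈ on on′ with allPairs-lookup (map⁻ separated) l∈ l′∈
  ... | inj₁ eq         = inj₁ eq
  ... | inj₂ (inj₁ sep) = inj₂ (separated-meet l l′ sep on on′)
  ... | inj₂ (inj₂ sep) = let v , end′ , end , eq = separated-meet l′ l sep on′ on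
                          in inj₂ (v , end , end′ , eq)

  -- The vertex is an end of some link `l′`, so it is a point where `l` and `l′` meet. Hence the
  -- links coincide or the vertex is their common end, and separation of links already keeps
  -- vertices off foreign links.
  core-on-link : ∀ v {l} → l ∈ links → pos v OnSegment l → End v l
  core-on-link v {l} l∈ on with l′ , l′∈ , end′ ← find (touched v)
    with links-meet l∈ l′∈ on (end-on-segment l′ end′)
  ... | inj₁ refl = end′
  ... | inj₂ (u , end , _ , eq) with refl ← site-injective v u (point-injective eq) = end

  wall-off-link : ∀ y l → ¬ (point (w , y) OnSegment l)
  wall-off-link y (a , b) = strictly-beside (point (w , 0)) (point (w , 1)) (pos a) (pos b) (point (w , y))
    (left⇒positive (w , 0) (w , 1) (site a) (site-left a))
    (left⇒positive (w , 0) (w , 1) (site b) (site-left b))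
    (trans (side-point (w , 0) (w , 1) (w , y))
      (trans (cong (λ m → fromℕ m ℚ.- fromℕ (minus (w , 0) (w , 1) (w , y))) (wall-collinear y))
        (ℚ.+-inverseʳ (fromℕ (minus (w , 0) (w , 1) (w , y))))))

  vertex-on-edge : ∀ v e → position v ∈[ position (end₁ e) , position (end₂ e) ] → Incident v e
  vertex-on-edge v e on with splitAt n v in eq
  ... | inj₁ a = subst (λ u → Incident u e) (Fin.splitAt⁻¹-↑ˡ eq)
    (end⇒incident e (core-on-link a (linkOf∈ e) (on⇒segment e on)))
  ... | inj₂ j = contradiction (on⇒segment e on) (wall-off-link (toℕ j) (linkOf e))

  drawing : PlaneDrawing graph
  drawing = record
    { position           = position
    ; corners            = λ _ → []
    ; position-injective = position-injective
    ; edge-isArc         = λ e eq → ends-differ e (position-injective eq)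
    ; vertex-on-edge     = vertex-on-edge
    ; edges-meet-at-ends = edges-meet
    }
    where
    edges-meet : ∀ e e′ → e ≢ e′ → ∀ p →
      p ∈[ position (end₁ e) , position (end₂ e) ] → p ∈[ position (end₁ e′) , position (end₂ e′) ] →
      ∃[ v ] Incident v e × Incident v e′ × p ≡ position v
    edges-meet e e′ e≢e′ p on on′
      with links-meet (linkOf∈ e) (linkOf∈ e′) (on⇒segment e on) (on⇒segment e′ on′)
    ... | inj₁ eq = contradiction (linkOf-injective e e′ eq) e≢e′
    ... | inj₂ (v , end , end′ , eq) =
      ι v , end⇒incident e end , end⇒incident e′ end′ , trans eq (sym (position-ι v))

-- The core graph

-- The 7 hubs come first, then 9 blocks of 7 inner vertices: 70 = 7 + 9 * 7.
Core : Set
Core = Fin 70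

Link : Set
Link = Pair 70

_≟ˡ_ : (l l′ : Link) → Dec (l ≡ l′)
_≟ˡ_ = ≡-dec _≟_ _≟_

hub : Fin 7 → Core
hub b = b ↑ˡ 63

inner : Fin 9 → Fin 7 → Core
inner g j = 7 ↑ʳ combine g j

-- K₄ on 0, 1, 2, 3, with vertices 4, 5, 6 stacked into three of its faces.
hubLinks : List (Fin 7 × Fin 7)
hubLinks =
  (0F , 1F) ∷ (0F , 2F) ∷ (0F , 3F) ∷ (1F , 2F) ∷ (1F , 3F) ∷ (2F , 3F) ∷
  (0F , 4F) ∷ (1F , 4F) ∷ (2F , 4F) ∷
  (0F , 5F) ∷ (2F , 5F) ∷ (3F , 5F) ∷
  (0F , 6F) ∷ (1F , 6F) ∷ (3F , 6F) ∷ []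

-- The faces around 4, 5 and 6, with that vertex first.
faces : Vec (Vec (Fin 7) 3) 9
faces =
  (4F ∷ 0F ∷ 1F ∷ []) ∷ (4F ∷ 1F ∷ 2F ∷ []) ∷ (4F ∷ 2F ∷ 0F ∷ []) ∷
  (5F ∷ 0F ∷ 2F ∷ []) ∷ (5F ∷ 2F ∷ 3F ∷ []) ∷ (5F ∷ 3F ∷ 0F ∷ []) ∷
  (6F ∷ 0F ∷ 3F ∷ []) ∷ (6F ∷ 3F ∷ 1F ∷ []) ∷ (6F ∷ 1F ∷ 0F ∷ []) ∷ []

corner : Fin 9 → Fin 3 → Fin 7
corner g = lookup (lookup faces g)

-- The dual of Tutte's fragment. Labels 0, 1, 2 are the corners of the face, and
-- 3 + j is the inner vertex j: a hexagon 0, …, 5 and its centre 6. Every edge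
-- off the outer triangle has an inner end, which is stored second.
opaque
  fragment : List (Fin 10 × Fin 7)
  fragment =
    (0F , 0F) ∷ (0F , 5F) ∷
    (1F , 5F) ∷ (1F , 4F) ∷ (1F , 3F) ∷ (1F , 2F) ∷
    (2F , 0F) ∷ (2F , 1F) ∷ (2F , 2F) ∷
    (3F , 1F) ∷ (4F , 2F) ∷ (5F , 3F) ∷ (6F , 4F) ∷ (7F , 5F) ∷ (3F , 5F) ∷
    (4F , 3F) ∷
    (3F , 6F) ∷ (4F , 6F) ∷ (6F , 6F) ∷ (7F , 6F) ∷ (8F , 6F) ∷ []

place : Fin 9 → Fin 10 → Core
place g k = [ hub ∘ corner g , inner g ]′ (splitAt 3 k)

hubLink : Fin 7 × Fin 7 → Link
hubLink (a , b) = hub a , hub b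

fragmentLink : Fin 9 → Fin 10 × Fin 7 → Link
fragmentLink g (k , j) = place g k , inner g j

opaque
  links : List Link
  links = List.map hubLink hubLinks ++ concatMap (λ g → List.map (fragmentLink g) fragment) (allFin 9)

  hubLink∈ : ∀ {e} → e ∈ hubLinks → hubLink e ∈ links
  hubLink∈ e∈ = ∈-++⁺ˡ (∈-map⁺ hubLink e∈)

  fragmentLink∈ : ∀ g {e} → e ∈ fragment → fragmentLink g e ∈ links
  fragmentLink∈ g e∈ = ∈-++⁺ʳ (List.map hubLink hubLinks)
    (∈-concatMap⁺ (λ g → List.map (fragmentLink g) fragment)
      (lose (∈-allFin g) (∈-map⁺ (fragmentLink g) e∈)))

opaque
  unfolding links fragment

  links-ordered : ∀ {l} → l ∈ links → proj₁ l Fin.< proj₂ l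
  links-ordered = All.lookup (from-yes (All.all? (λ (a , b) → a Fin.<? b) links))

  place-injective : ∀ g i j → place g i ≡ place g j → i ≡ j
  place-injective = from-yes (all? λ g → all? λ i → all? λ j → (place g i ≟ place g j) →-dec (i ≟ j))

  fragment-unique : Unique fragment
  fragment-unique = from-yes (AllPairs.allPairs? (λ e e′ → ¬? (≡-dec _≟_ _≟_ e e′)) fragment)

inner-injective : ∀ {g h i j} → inner g i ≡ inner h j → g ≡ h × i ≡ j
inner-injective {g} {h} {i} {j} eq = Fin.combine-injective g i h j (Fin.↑ʳ-injective 7 _ _ eq)

hub≢inner : ∀ {b g j} → hub b ≢ inner g j
hub≢inner {b} {g} {j} eq
  with () ← trans (sym (Fin.splitAt-↑ˡ 7 b 63)) (trans (cong (splitAt 7) eq) (Fin.splitAt-↑ʳ 7 63 (combine g j)))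

fragmentLink-injective : ∀ g {e e′} → fragmentLink g e ≡ fragmentLink g e′ → e ≡ e′
fragmentLink-injective g eq with p , q ← ,-injective eq =
  cong₂ _,_ (place-injective g _ _ p) (proj₂ (inner-injective {g} {g} q))

-- Two colours do not suffice

Mono : Vec Bool 10 → Fin 10 × Fin 7 → Set
Mono v (k , j) = lookup v k ≡ lookup v (3 ↑ʳ j)

-- A corner end imposes no condition, since the count is made for a fragment in which no corner
-- selects an edge: the selecting end is then an inner vertex, hence in `S`.
Inside : List (Fin 7) → Fin 10 × Fin 7 → Set
Inside S (k , j) = [ const ⊤ , _∈ S ]′ (splitAt 3 k) × j ∈ S

mono? : ∀ v → Decidable (Mono v)
mono? v (k , j) = lookup v k Bool.≟ lookup v (3 ↑ʳ j)

inside? : ∀ S → Decidable (Inside S)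
inside? S (k , j) with splitAt 3 k
... | inj₁ _ = yes tt ×-dec Any.any? (j ≟_) S
... | inj₂ i = Any.any? (i ≟_) S ×-dec Any.any? (j ≟_) S

MonoInside? : ∀ v S → Decidable (λ e → Mono v e × Inside S e)
MonoInside? v S e = mono? v e ×-dec inside? S e

-- Whenever the first corner is coloured unlike the other two, one of these sets
-- of inner vertices is too small to select all the monochromatic edges that
-- have no other inner end.
overloaded : List (List (Fin 7))
overloaded =
  (0F ∷ 1F ∷ 2F ∷ 3F ∷ 4F ∷ 5F ∷ 6F ∷ []) ∷ (0F ∷ 3F ∷ 5F ∷ 6F ∷ []) ∷
  (1F ∷ 3F ∷ []) ∷ (0F ∷ 5F ∷ []) ∷ (1F ∷ 5F ∷ 6F ∷ []) ∷ []

Odd : ∀ {n} → Vec Bool n → Fin n → Fin n → Fin n → Set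
Odd v a b c = lookup v a ≢ lookup v b × lookup v b ≡ lookup v c

odd? : ∀ {n} (v : Vec Bool n) a b c → Dec (Odd v a b c)
odd? v a b c = ¬? (lookup v a Bool.≟ lookup v b) ×-dec (lookup v b Bool.≟ lookup v c)

opaque
  unfolding fragment

  -- A violation of Hall's condition, verified by running through the 1024 colourings of the ten
  -- labels.
  fragment-overloaded : ∀ v → Odd v 0F 1F 2F →
    Any (λ S → length S ℕ.< length (filter (MonoInside? v S) fragment)) overloaded
  fragment-overloaded = from-yes (allVec? λ v → odd? v 0F 1F 2F →-dec
    Any.any? (λ S → length S ℕ.<? length (filter (MonoInside? v S) fragment)) overloaded)

-- What the hubs have to select: a given edge between hubs, or any edge of a given fragment.
Demand : Set
Demand = (Fin 7 × Fin 7) ⊎ Fin 9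

opaque
  demands : List Demand
  demands = List.map inj₁ hubLinks ++ List.map inj₂ (allFin 9)

  demand-sound : ∀ {e} → inj₁ e ∈ demands → e ∈ hubLinks
  demand-sound d∈ with ∈-++⁻ (List.map inj₁ hubLinks) d∈
  ... | inj₁ d∈′ with _ , e∈ , refl ← ∈-map⁻ inj₁ d∈′ = e∈
  ... | inj₂ d∈′ with _ , _ , () ← ∈-map⁻ inj₂ d∈′

  demands-unique : Unique demands
  demands-unique = from-yes (AllPairs.allPairs? (λ d d′ → ¬? (Sum.≡-dec (≡-dec _≟_ _≟_) _≟_ d d′)) demands)

Demanded : Vec Bool 7 → Demand → Set
Demanded v (inj₁ (a , b)) = lookup v a ≡ lookup v b
Demanded v (inj₂ g)       = Odd v (corner g 0F) (corner g 1F) (corner g 2F)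

demanded? : ∀ v → Decidable (Demanded v)
demanded? v (inj₁ (a , b)) = lookup v a Bool.≟ lookup v b
demanded? v (inj₂ g)       = odd? v (corner g 0F) (corner g 1F) (corner g 2F)

opaque
  unfolding demands

  -- The least count is 8. K₄ has at least 2 monochromatic edges. A stacked vertex, whatever its
  -- colour, adds 3 demands if its face of K₄ is monochromatic and 2 otherwise, counting its own
  -- monochromatic edges and the odd faces around it.
  hubs-overloaded : ∀ v → 7 ℕ.< length (filter (demanded? v) demands)
  hubs-overloaded = from-yes (allVec? λ v → 7 ℕ.<? length (filter (demanded? v) demands))

module _ (cover : Cover links) where
  open Cover cover

  SelectsIn : Fin 9 → Core → Set
  SelectsIn g s = Any (Selects s ∘ fragmentLink g) fragment

  selectsIn? : ∀ g → Decidable (SelectsIn g)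
  selectsIn? g s = Any.any? (λ e → selects? s (fragmentLink g e)) fragment

  fragmentColors : Fin 9 → Vec Bool 10
  fragmentColors g = tabulate (color ∘ place g)

  hubColors : Vec Bool 7
  hubColors = tabulate (color ∘ hub)

  mono⇒same : ∀ g {k j} → Mono (fragmentColors g) (k , j) → color (place g k) ≡ color (inner g j)
  mono⇒same g {k} {j} mono =
    trans (sym (lookup∘tabulate (color ∘ place g) k))
      (trans mono
        (trans (lookup∘tabulate (color ∘ place g) (3 ↑ʳ j))
          (cong (color ∘ [ hub ∘ corner g , inner g ]′) (Fin.splitAt-↑ʳ 3 7 j))))

  -- One end selects the edge by `covers`, and `unpaid` rules out a corner.
  selected-inside : ∀ g → ¬ (∃[ i ] SelectsIn g (hub (corner g i))) →
    ∀ {S e} → e ∈ fragment → Mono (fragmentColors g) e × Inside S e →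
    ∃[ s ] s ∈ S × Selects (inner g s) (fragmentLink g e)
  selected-inside g unpaid {S} {k , j} e∈ (mono , k∈ , j∈)
    with covers (fragmentLink∈ g e∈) (mono⇒same g {k} {j} mono)
  ... | inj₂ sel = j , j∈ , sel
  ... | inj₁ sel with splitAt 3 k in eq
  ...   | inj₂ i = i , k∈ , sel
  ...   | inj₁ i = contradiction
    (i , lose e∈ (subst (λ z → Selects (hub (corner g i)) ([ hub ∘ corner g , inner g ]′ z , inner g j)) (sym eq) sel))
    unpaid

  -- If no corner paid, the monochromatic edges inside an overloaded set would have distinct
  -- selectors in that set, against the pigeonhole principle.
  odd⇒paid : ∀ g → Odd hubColors (corner g 0F) (corner g 1F) (corner g 2F) →
    ∃[ b ] SelectsIn g (hub b)
  odd⇒paid g (a≢b , b≡c) with any? (λ i → selectsIn? g (hub (corner g i)))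
  ... | yes (i , sel) = corner g i , sel
  ... | no unpaid     = ⊥-elim (absurd (find (fragment-overloaded (fragmentColors g) (a≢b′ , b≡c′))))
    where
    hubColor : ∀ b → lookup hubColors b ≡ color (hub b)
    hubColor = lookup∘tabulate (color ∘ hub)

    a≢b′ : color (hub (corner g 0F)) ≢ color (hub (corner g 1F))
    a≢b′ eq = a≢b (trans (hubColor (corner g 0F)) (trans eq (sym (hubColor (corner g 1F)))))

    b≡c′ : color (hub (corner g 1F)) ≡ color (hub (corner g 2F))
    b≡c′ = trans (sym (hubColor (corner g 1F))) (trans b≡c (hubColor (corner g 2F)))

    absurd : ¬ (∃[ S ] S ∈ overloaded ×
                length S ℕ.< length (filter (MonoInside? (fragmentColors g) S) fragment))
    absurd (S , _ , too-many) = ℕ.<⇒≱ too-many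
      (pigeonhole (λ e s → Selects (inner g s) (fragmentLink g e))
        (filter⁺ (MonoInside? (fragmentColors g) S) fragment-unique)
        (λ e∈ → let e∈′ , inside = ∈-filter⁻ (MonoInside? (fragmentColors g) S) {xs = fragment} e∈
                in selected-inside g unpaid e∈′ inside)
        (λ e∈ e′∈ sel sel′ → fragmentLink-injective g
          (functional (fragmentLink∈ g (proj₁ (∈-filter⁻ (MonoInside? (fragmentColors g) S) {xs = fragment} e∈)))
                      (fragmentLink∈ g (proj₁ (∈-filter⁻ (MonoInside? (fragmentColors g) S) {xs = fragment} e′∈)))
                      sel sel′)))

  Pays : Demand → Fin 7 → Set
  Pays (inj₁ e) b = Selects (hub b) (hubLink e)
  Pays (inj₂ g) b = SelectsIn g (hub b)

  demanded⇒paid : ∀ {d} → d ∈ demands → Demanded hubColors d → ∃[ b ] Pays d b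
  demanded⇒paid {inj₁ (a , b)} d∈ same
    with covers (hubLink∈ (demand-sound d∈))
           (trans (sym (lookup∘tabulate (color ∘ hub) a)) (trans same (lookup∘tabulate (color ∘ hub) b)))
  ... | inj₁ sel = a , sel
  ... | inj₂ sel = b , sel
  demanded⇒paid {inj₂ g} _ odd = odd⇒paid g odd

  -- A hub selects only one link, and the second end of a link tells which demand it can meet: a hub
  -- for a hub link, an inner vertex of `g` for fragment `g`.
  pays-functional : ∀ {d d′ b} → d ∈ demands → d′ ∈ demands → Pays d b → Pays d′ b → d ≡ d′
  pays-functional {inj₁ _} {inj₁ _} d∈ d′∈ sel sel′
    with p , q ← ,-injective (functional (hubLink∈ (demand-sound d∈)) (hubLink∈ (demand-sound d′∈)) sel sel′) =
    cong inj₁ (cong₂ _,_ (Fin.↑ˡ-injective 63 _ _ p) (Fin.↑ˡ-injective 63 _ _ q))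
  pays-functional {inj₁ _} {inj₂ g} d∈ _ sel any′ with e , e∈ , sel′ ← find any′ =
    contradiction (cong proj₂ (functional (hubLink∈ (demand-sound d∈)) (fragmentLink∈ g e∈) sel sel′)) (hub≢inner {g = g})
  pays-functional {inj₂ g} {inj₁ _} _ d′∈ any sel′ with e , e∈ , sel ← find any =
    contradiction (cong proj₂ (functional (hubLink∈ (demand-sound d′∈)) (fragmentLink∈ g e∈) sel′ sel)) (hub≢inner {g = g})
  pays-functional {inj₂ g} {inj₂ g′} _ _ any any′
    with e , e∈ , sel ← find any | e′ , e′∈ , sel′ ← find any′ =
    cong inj₂ (proj₁ (inner-injective {g} {g′}
      (cong proj₂ (functional (fragmentLink∈ g e∈) (fragmentLink∈ g′ e′∈) sel sel′))))

  no-cover : ⊥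
  no-cover = ℕ.<⇒≱ (hubs-overloaded hubColors)
    (pigeonhole Pays {ys = allFin 7} (filter⁺ (demanded? hubColors) demands-unique)
      (λ d∈ → let d∈′ , demanded = ∈-filter⁻ (demanded? hubColors) {xs = demands} d∈
                  b , pays = demanded⇒paid d∈′ demanded
              in b , ∈-allFin b , pays)
      (λ d∈ d′∈ → pays-functional
        (proj₁ (∈-filter⁻ (demanded? hubColors) {xs = demands} d∈))
        (proj₁ (∈-filter⁻ (demanded? hubColors) {xs = demands} d′∈))))

-- Three colours suffice

-- K₄ is split into two pairs and the stacked vertices take the third colour. Only the hub edges 01
-- and 23 are monochromatic; `hubChoice` lets 0 and 2 select them.
hubColor : Vec (Fin 3) 7
hubColor = 0F ∷ 0F ∷ 1F ∷ 1F ∷ 2F ∷ 2F ∷ 2F ∷ []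

-- All fragments are coloured alike, up to a rotation of the colours that
-- suits the colours of their corners.
innerColor : Vec (Fin 3) 7
innerColor = 0F ∷ 0F ∷ 1F ∷ 1F ∷ 0F ∷ 1F ∷ 2F ∷ []

-- The inner selections take care of every edge at corner 0 and of every monochromatic edge between
-- inner vertices. With rotation `r` it remains that, modulo 3, corner 1 must avoid colour `r + 1`
-- and corner 2 colour `r`.
rotation : Vec (Fin 3) 9
rotation = 1F ∷ 0F ∷ 1F ∷ 0F ∷ 2F ∷ 1F ∷ 0F ∷ 1F ∷ 1F ∷ []

coreColor : Core → Fin 3
coreColor v = [ lookup hubColor , (λ x → let g , j = remQuot 7 x in
  (toℕ (lookup innerColor j) ℕ.+ toℕ (lookup rotation g)) mod 3) ]′ (splitAt 7 v)

hubChoice : Vec (Maybe (Fin 7 × Fin 7)) 7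
hubChoice = just (0F , 1F) ∷ nothing ∷ just (2F , 3F) ∷ nothing ∷ nothing ∷ nothing ∷ nothing ∷ []

-- The labels of the other ends of the edges selected by the inner vertices.
innerChoice : Vec (Maybe (Fin 10)) 7
innerChoice = just 0F ∷ just 3F ∷ just 2F ∷ just 5F ∷ just 1F ∷ just 0F ∷ nothing ∷ []

coreChoice : Core → Maybe Link
coreChoice v = [ Maybe.map hubLink ∘ lookup hubChoice , (λ x → let g , j = remQuot 7 x in
  Maybe.map (λ k → fragmentLink g (k , j)) (lookup innerChoice j)) ]′ (splitAt 7 v)

opaque
  unfolding links fragment

  choice-valid : ∀ v → MAll.All (λ l → (v ≡ proj₁ l ⊎ v ≡ proj₂ l) × l ∈ links) (coreChoice v)
  choice-valid = from-yes (all? λ v → MAll.dec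
    (λ l → (v ≟ proj₁ l ⊎-dec v ≟ proj₂ l) ×-dec Any.any? (l ≟ˡ_) links) (coreChoice v))

  choice-covers : ∀ {l} → l ∈ links → coreColor (proj₁ l) ≡ coreColor (proj₂ l) →
    coreChoice (proj₁ l) ≡ just l ⊎ coreChoice (proj₂ l) ≡ just l
  choice-covers = All.lookup (from-yes (All.all? (λ l →
    (coreColor (proj₁ l) ≟ coreColor (proj₂ l)) →-dec
    (Maybe.≡-dec _≟ˡ_ (coreChoice (proj₁ l)) (just l) ⊎-dec
     Maybe.≡-dec _≟ˡ_ (coreChoice (proj₂ l)) (just l))) links))

-- The drawing of the core

-- The face 123 of K₄, into which no vertex is stacked, is the outer one.
hubSite : Vec Site 7
hubSite = (4 , 3) ∷ (0 , 0) ∷ (10 , 0) ∷ (0 , 10) ∷ (3 , 2) ∷ (6 , 3) ∷ (1 , 5) ∷ []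

-- Barycentric coordinates, in sevenths, with respect to the corners of the face.
weights : Vec (ℕ × ℕ × ℕ) 7
weights = (3 , 1 , 3) ∷ (1 , 1 , 5) ∷ (1 , 3 , 3) ∷ (2 , 3 , 2) ∷ (2 , 4 , 1) ∷ (4 , 2 , 1) ∷ (3 , 2 , 2) ∷ []

combination : ℕ × ℕ × ℕ → Site → Site → Site → Site
combination (α , β , γ) (x₁ , y₁) (x₂ , y₂) (x₃ , y₃) =
  α ℕ.* x₁ ℕ.+ β ℕ.* x₂ ℕ.+ γ ℕ.* x₃ , α ℕ.* y₁ ℕ.+ β ℕ.* y₂ ℕ.+ γ ℕ.* y₃

-- All coordinates are scaled by seven to make them integral.
site : Core → Site
site v = [ (λ b → let x , y = lookup hubSite b in 7 ℕ.* x , 7 ℕ.* y)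
         , (λ x → let g , j = remQuot 7 x; at = lookup hubSite ∘ corner g
                  in combination (lookup weights j) (at 0F) (at 1F) (at 2F)) ]′ (splitAt 7 v)

opaque
  unfolding links fragment

  sites-separated : AllPairs Separated (List.map (Segments.segment site) links)
  sites-separated = from-yes (AllPairs.allPairs? separated? (List.map (Segments.segment site) links))

  site-injective : ∀ a b → site a ≡ site b → a ≡ b
  site-injective = from-yes (all? λ a → all? λ b → ≡-dec ℕ._≟_ ℕ._≟_ (site a) (site b) →-dec (a ≟ b))

  -- Before scaling, x-coordinates are at most 10, so the scaled ones are at most 70 and the line x
  -- = 71 clears the core.
  site-left : ∀ a → Left (71 , 0) (71 , 1) (site a)
  site-left = from-yes (all? λ a → left? (71 , 0) (71 , 1) (site a))

  all-touched : ∀ v → Any (End v) links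
  all-touched = from-yes (all? λ v → Any.any? (end? v) links)

theorem1p3 : Σ[ G ∈ (ℕ → Graph) ] ((∀ i j → i ≢ j → ¬ Isomorphic (G i) (G j)) × (∀ i → Planar (G i) × IsRobustChromaticNumber (G i) 3))
theorem1p3 = Extension.graph links links-ordered
  -- An isomorphism forces the orders `70 + i` and `70 + j` to agree.
  , (λ i j i≢j (φ , _) → i≢j (ℕ.+-cancelˡ-≡ 70 i j (↔⇒≡ φ)))
  , λ i → Drawing.drawing links links-ordered site 71 site-injective site-left sites-separated all-touched i
        , Extension.robust-three links links-ordered i coreColor coreChoice choice-valid choice-covers no-cover
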